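{- Let $\Gamma$ be a finite connected simple $k$-regular graph of diameter at least $2$ with $v\ge 4$ vertices, where $2\le k\le v-2$, and with parameters $\lambda=\lambda(\Gamma)$, $\mu=\mu(\Gamma)$ satisfying $0\le\lambda\le k-2$ and $1\le\mu\le k$. Then: (i) if $\mu=1$, then $N_2(\Gamma,2)\ge k+1$; (ii) if $\mu=2$ and $N(\Gamma,1)=2$, then $N_2(\Gamma,2)\ge 2k$; (iii) if $\mu=3$ and $N(\Gamma,1)=3$, then $N_2(\Gamma,2)\ge 3k-5$.
   Context: Let $\Gamma=(V,E)$ be a finite connected simple graph with path distance $d$, and let $B_r(x)=\{y\in V: d(x,y)\le r\}$. Define - $\lambda(\Gamma)$: the maximum, over adjacent pairs $x,y$, of the number of common neighbors of $x$ and $y$; - $\mu(\Gamma)$: the maximum, over pairs $x,y$ with $d(x,y)=2$, of the number of common neighbors of $x$ and $y$; - $N(\Gamma,r)=\max\{|B_r(x)\cap B_r(y)|: x,y\in V,\ x\neq y\}$; - $N_s(\Gamma,r)=\max\{|B_r(x)\cap B_r(y)|: x,y\in V,\ d(x,y)=s\}$. -}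

module Defs where

open import Data.Fin.Base using (Fin)
open import Data.Fin.Properties using (any?; _≟_)
open import Data.Fin.Subset using (Subset; _∩_; ∣_∣)
open import Data.List.Base using (allFin; cartesianProduct; filter; map)
open import Data.List.Extrema.Nat using (max)
open import Data.Nat.Base using (ℕ; zero; suc; _≤_; z≤n; s≤s)
open import Data.Nat.Properties as ℕ using (_≤?_)
open import Data.Product.Base using (∃-syntax; _×_; _,_; proj₁; proj₂; uncurry)
open import Data.Unit.Base using (⊤; tt)
open import Data.Vec.Base using (tabulate)
open import Level using (0ℓ)
open import Relation.Binary.Core using (Rel)
open import Relation.Binary.Definitions using (Decidable; Symmetric)
open import Relation.Binary.PropositionalEquality using (refl; _≡_)
open import Relation.Nullary using (¬_; yes; no; does; contradiction; ¬?)
open import Relation.Nullary.Decidable using (map′; _×-dec_)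
import Relation.Unary as U

record SimpleGraph (v : ℕ) : Set₁ where
  field
    Adj    : Rel (Fin v) 0ℓ
    adj?   : Decidable Adj
    sym    : Symmetric Adj
    irrefl : ∀ {x} → ¬ Adj x x

least : {P : ℕ → Set} → U.Decidable P → ∀ n → P n →
        ∃[ m ] P m × (∀ {k} → P k → m ≤ k)
least P? n pn with P? zero
least P? n       pn | yes p0 = zero , p0 , λ _ → z≤n
least P? zero    pn | no ¬p0 = contradiction pn ¬p0
least {P} P? (suc n) pn | no ¬p0
  with m , pm , minimal ← least (λ k → P? (suc k)) n pn
  = suc m , pm , bound
  where
  bound : ∀ {k} → P k → suc m ≤ k
  bound {zero}  p = contradiction p ¬p0
  bound {suc k} p = s≤s (minimal p)

-- The maximum of f over all pairs satisfying P; 0 if there is no such pair.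
maxOver : ∀ {v} {P : Rel (Fin v) 0ℓ} → Decidable P → (Fin v → Fin v → ℕ) → ℕ
maxOver {v} P? f =
  max 0 (map (uncurry f)
             (filter (λ p → P? (proj₁ p) (proj₂ p))
                     (cartesianProduct (allFin v) (allFin v))))

module _ {v : ℕ} (Γ : SimpleGraph v) where
  open SimpleGraph Γ

  data Walk : ℕ → Rel (Fin v) 0ℓ where
    nil  : ∀ {x} → Walk zero x x
    cons : ∀ {n x y z} → Adj x y → Walk n y z → Walk (suc n) x z

  walk? : ∀ n → Decidable (Walk n)
  walk? zero x y = map′ (λ { refl → nil }) (λ { nil → refl }) (x ≟ y)
  walk? (suc n) x z =
    map′ (λ { (y , a , w) → cons a w }) (λ { (cons {y = y} a w) → y , a , w })
         (any? (λ y → adj? x y ×-dec walk? n y z))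

  Connected : Set
  Connected = ∀ x y → ∃[ n ] Walk n x y

  neighbours : Fin v → Subset v
  neighbours x = tabulate (λ y → does (adj? x y))

  Regular : ℕ → Set
  Regular k = ∀ x → ∣ neighbours x ∣ ≡ k

  commonNeighbours : Fin v → Fin v → ℕ
  commonNeighbours x y = ∣ neighbours x ∩ neighbours y ∣

  module Metric (connected : Connected) where

    -- Walks may repeat vertices, but a shortest walk is a path, so this is the
    -- usual path distance.
    shortest : ∀ x y → ∃[ n ] Walk n x y × (∀ {m} → Walk m x y → n ≤ m)
    shortest x y = least (λ n → walk? n x y) (proj₁ (connected x y)) (proj₂ (connected x y))

    d : Fin v → Fin v → ℕ
    d x y = proj₁ (shortest x y)

    diameter : ℕ
    diameter = maxOver {P = λ _ _ → ⊤} (λ _ _ → yes tt) d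

    B : ℕ → Fin v → Subset v
    B r x = tabulate (λ y → does (d x y ≤? r))

    λᴳ : ℕ
    λᴳ = maxOver adj? commonNeighbours

    μᴳ : ℕ
    μᴳ = maxOver (λ x y → d x y ℕ.≟ 2) commonNeighbours

    N : ℕ → ℕ
    N r = maxOver (λ x y → ¬? (x ≟ y)) (λ x y → ∣ B r x ∩ B r y ∣)

    N[d≡_] : ℕ → ℕ → ℕ
    N[d≡ s ] r = maxOver (λ x y → d x y ℕ.≟ s) (λ x y → ∣ B r x ∩ B r y ∣)

{-# OPTIONS --safe #-}
-- Two vertices at distance two with exactly μ common neighbours z exist, and the
-- unit balls of these z all lie in the intersection of the 2-balls.  Each unit
-- ball has k + 1 elements and two of them share at most N(Γ,1), so inclusion–
-- exclusion bounds the size of their union from below.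
module Submission where

open import Data.Fin.Base using (Fin; zero; suc)
open import Data.Fin.Properties using (_≟_)
open import Data.Fin.Subset using (Subset; inside; outside; _∈_; _⊆_; _∩_; _∪_; _-_; ∣_∣)
open import Data.Fin.Subset.Properties
  using (p─⊥≡p; p─q⊆p; x∈p∩q⁺; x∈p∩q⁻; x∈p∪q⁻; p⊆q⇒∣p∣≤∣q∣; p⊂q⇒∣p∣<∣q∣; x∈p⇒∣p-x∣<∣p∣; ∩-distribˡ-∪)
open import Data.List.Base using (List; allFin; cartesianProduct; filter; map)
open import Data.List.Extrema.Nat using (argmax-sel; xs≤max)
open import Data.List.Membership.Propositional.Properties
  using (∈-map∘filter⁺; ∈-map∘filter⁻; ∈-cartesianProduct⁺; ∈-allFin)
open import Data.List.Relation.Unary.All as All using ()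
open import Data.Nat.Base using (ℕ; suc; _+_; _*_; _∸_; _≤_; _<_; _≥_; z≤n; s≤s; s≤s⁻¹)
open import Data.Nat.Properties
  using (≤-refl; ≤-reflexive; ≤-trans; ≤-<-trans; +-mono-≤; +-monoʳ-≤; +-cancelʳ-≤;
         +-suc; +-comm; m≤n+o⇒m∸n≤o; module ≤-Reasoning)
import Data.Nat.Properties as ℕ
open import Data.Nat.Tactic.RingSolver using (solve-∀)
open import Data.Product.Base using (_×_; _,_; proj₁; proj₂; ∃-syntax; uncurry)
open import Data.Sum.Base using (inj₁; inj₂; [_,_])
open import Data.Vec.Base using (tabulate; []; _∷_; here; there)
open import Data.Vec.Properties using (lookup∘tabulate; lookup⇒[]=; []=⇒lookup)
open import Function.Base using (_∘_)
open import Level using (0ℓ)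
open import Relation.Binary.Core using (Rel)
open import Relation.Binary.Definitions using (Decidable)
open import Relation.Binary.PropositionalEquality
  using (_≡_; _≢_; refl; sym; trans; cong; subst; module ≡-Reasoning)
open import Relation.Nullary using (yes; does; contradiction; ¬?)
open import Relation.Nullary.Decidable using (dec-true)
import Relation.Unary as U
open import Defs

-- Finite subsets and inclusion-exclusion

∈-tabulate⁺ : ∀ {n} {P : U.Pred (Fin n) 0ℓ} (P? : U.Decidable P) {x} →
              P x → x ∈ tabulate (does ∘ P?)
∈-tabulate⁺ P? {x} px = lookup⇒[]= x _ (trans (lookup∘tabulate _ x) (dec-true (P? x) px))

∈-tabulate⁻ : ∀ {n} {P : U.Pred (Fin n) 0ℓ} (P? : U.Decidable P) {x} →
              x ∈ tabulate (does ∘ P?) → P x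
∈-tabulate⁻ P? {x} x∈ with P? x | trans (sym (lookup∘tabulate (does ∘ P?) x)) ([]=⇒lookup x∈)
... | yes px | _ = px

x∈p-y⇒x≢y : ∀ {n} (p : Subset n) {x y} → x ∈ p - y → x ≢ y
-- At `zero` the head of the difference computes to `outside`, so no membership proof exists and
-- only the `suc` case remains.
x∈p-y⇒x≢y (_ ∷ p) {suc x} (there x∈) refl = x∈p-y⇒x≢y p x∈ refl

0<∣p∣ : ∀ {n x} {p : Subset n} → x ∈ p → 0 < ∣ p ∣
0<∣p∣ x∈p = ≤-<-trans z≤n (x∈p⇒∣p-x∣<∣p∣ x∈p)

-- The bound on `p - x` allows iteration: picking again from `p - x` yields an element distinct from
-- `x`. The element taken is the first one marked `inside`.
pick : ∀ {n m} (p : Subset n) → m < ∣ p ∣ → ∃[ x ] x ∈ p × m ≤ ∣ p - x ∣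
pick (inside ∷ p) m<∣p∣ =
  zero , here , subst (λ q → _ ≤ ∣ q ∣) (sym (p─⊥≡p p)) (s≤s⁻¹ m<∣p∣)
pick (outside ∷ p) m<∣p∣ with x , x∈p , m≤ ← pick p m<∣p∣ = suc x , there x∈p , m≤

-- Each position contributes equally to both sides: 2 if it lies in both sets, 1 if in exactly one.
-- The additive form avoids truncated subtraction.
∣p∪q∣+∣p∩q∣≡∣p∣+∣q∣ : ∀ {n} (p q : Subset n) → ∣ p ∪ q ∣ + ∣ p ∩ q ∣ ≡ ∣ p ∣ + ∣ q ∣
∣p∪q∣+∣p∩q∣≡∣p∣+∣q∣ [] [] = refl
∣p∪q∣+∣p∩q∣≡∣p∣+∣q∣ (inside ∷ p) (inside ∷ q) =
  cong suc (trans (+-suc _ _) (trans (cong suc (∣p∪q∣+∣p∩q∣≡∣p∣+∣q∣ p q)) (sym (+-suc _ _))))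
∣p∪q∣+∣p∩q∣≡∣p∣+∣q∣ (inside ∷ p) (outside ∷ q) = cong suc (∣p∪q∣+∣p∩q∣≡∣p∣+∣q∣ p q)
∣p∪q∣+∣p∩q∣≡∣p∣+∣q∣ (outside ∷ p) (inside ∷ q) =
  trans (cong suc (∣p∪q∣+∣p∩q∣≡∣p∣+∣q∣ p q)) (sym (+-suc _ _))
∣p∪q∣+∣p∩q∣≡∣p∣+∣q∣ (outside ∷ p) (outside ∷ q) = ∣p∪q∣+∣p∩q∣≡∣p∣+∣q∣ p q

-- Three uses of the two-set identity: for `p` and `q ∪ r`, for `q` and `r`, and for `p ∩ q` and
-- `p ∩ r`, whose union is `p ∩ (q ∪ r)`. The last use is why the triple intersection appears as
-- `(p ∩ q) ∩ (p ∩ r)`.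
∣p∪q∪r∣+∣pairs∣≡∣p∣+∣q∣+∣r∣+∣p∩q∩r∣ : ∀ {n} (p q r : Subset n) →
  ∣ p ∪ (q ∪ r) ∣ + (∣ p ∩ q ∣ + ∣ p ∩ r ∣ + ∣ q ∩ r ∣) ≡
  ∣ p ∣ + ∣ q ∣ + ∣ r ∣ + ∣ (p ∩ q) ∩ (p ∩ r) ∣
∣p∪q∪r∣+∣pairs∣≡∣p∣+∣q∣+∣r∣+∣p∩q∩r∣ p q r = begin
  u + (∣ p ∩ q ∣ + ∣ p ∩ r ∣ + c)  ≡⟨ cong (λ s → u + (s + c)) (∣p∪q∣+∣p∩q∣≡∣p∣+∣q∣ (p ∩ q) (p ∩ r)) ⟨
  u + (a + t + c)                  ≡⟨ regroup₁ u a t c ⟩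
  u + a + (t + c)                  ≡⟨ cong (λ s → u + ∣ s ∣ + (t + c)) (∩-distribˡ-∪ p q r) ⟨
  u + ∣ p ∩ (q ∪ r) ∣ + (t + c)    ≡⟨ cong (_+ (t + c)) (∣p∪q∣+∣p∩q∣≡∣p∣+∣q∣ p (q ∪ r)) ⟩
  ∣ p ∣ + ∣ q ∪ r ∣ + (t + c)      ≡⟨ regroup₂ (∣ p ∣) (∣ q ∪ r ∣) t c ⟩
  ∣ p ∣ + (∣ q ∪ r ∣ + c) + t      ≡⟨ cong (λ s → ∣ p ∣ + s + t) (∣p∪q∣+∣p∩q∣≡∣p∣+∣q∣ q r) ⟩
  ∣ p ∣ + (∣ q ∣ + ∣ r ∣) + t      ≡⟨ regroup₃ (∣ p ∣) (∣ q ∣) (∣ r ∣) t ⟩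
  ∣ p ∣ + ∣ q ∣ + ∣ r ∣ + t        ∎
  where
  open ≡-Reasoning

  u a c t : ℕ
  u = ∣ p ∪ (q ∪ r) ∣
  a = ∣ (p ∩ q) ∪ (p ∩ r) ∣
  c = ∣ q ∩ r ∣
  t = ∣ (p ∩ q) ∩ (p ∩ r) ∣

  regroup₁ : ∀ u a t c → u + (a + t + c) ≡ u + a + (t + c)
  regroup₁ = solve-∀

  regroup₂ : ∀ l m t c → l + m + (t + c) ≡ l + (m + c) + t
  regroup₂ = solve-∀

  regroup₃ : ∀ l m n t → l + (m + n) + t ≡ l + m + n + t
  regroup₃ = solve-∀

∪-lub : ∀ {n} {p q r : Subset n} → p ⊆ r → q ⊆ r → p ∪ q ⊆ r
∪-lub {p = p} {q} p⊆r q⊆r x∈ = [ p⊆r , q⊆r ] (x∈p∪q⁻ p q x∈)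

-- Maxima over pairs of vertices

module _ {v} {P : Rel (Fin v) 0ℓ} (P? : Decidable P) (f : Fin v → Fin v → ℕ) where

  private
    pairs : List (Fin v × Fin v)
    pairs = cartesianProduct (allFin v) (allFin v)

    values : List ℕ
    values = map (uncurry f) (filter (λ p → P? (proj₁ p) (proj₂ p)) pairs)

  ≤maxOver : ∀ x y → P x y → f x y ≤ maxOver P? f
  ≤maxOver x y pxy = All.lookup (xs≤max 0 values)
    (∈-map∘filter⁺ (uncurry f) (λ p → P? (proj₁ p) (proj₂ p))
      ((x , y) , ∈-cartesianProduct⁺ (∈-allFin x) (∈-allFin y) , refl , pxy))

  -- A positive maximum cannot be the default 0, so it is one of the listed values and comes from a
  -- pair satisfying `P`.
  maxOver-attained : 0 < maxOver P? f → ∃[ x ] ∃[ y ] P x y × maxOver P? f ≡ f x y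
  maxOver-attained 0<max with argmax-sel (λ n → n) 0 values
  ... | inj₁ max≡0 = contradiction (subst (0 <_) max≡0 0<max) λ ()
  ... | inj₂ max∈ with (x , y) , _ , max≡ , pxy ← ∈-map∘filter⁻ (uncurry f) (λ p → P? (proj₁ p) (proj₂ p)) {xs = pairs} max∈ =
    x , y , pxy , max≡

-- Walks and balls in a regular graph

module _ {v k : ℕ} (Γ : SimpleGraph v) (connected : Connected Γ) (regular : Regular Γ k) where
  open SimpleGraph Γ renaming (sym to Adj-sym)
  open Metric Γ connected

  d≤ : ∀ {n x y} → Walk Γ n x y → d x y ≤ n
  d≤ {x = x} {y} = proj₂ (proj₂ (shortest x y))

  shortestWalk : ∀ x y → Walk Γ (d x y) x y
  shortestWalk x y = proj₁ (proj₂ (shortest x y))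

  -- Any walk will do, shortest or not, since `d` is at most the length of every walk.
  ∈B⁺ : ∀ {n} r x y → Walk Γ n x y → n ≤ r → y ∈ B r x
  ∈B⁺ r x y w n≤r = ∈-tabulate⁺ (λ y → d x y ℕ.≤? r) (≤-trans (proj₂ (proj₂ (shortest x y)) w) n≤r)

  ∈B⁻ : ∀ r x y → y ∈ B r x → ∃[ n ] Walk Γ n x y × n ≤ r
  ∈B⁻ r x y y∈ =
    d x y , proj₁ (proj₂ (shortest x y)) , ∈-tabulate⁻ (λ y → d x y ℕ.≤? r) y∈

  ∈neighbours⁻ : ∀ {x y} → y ∈ neighbours Γ x → Adj x y
  ∈neighbours⁻ {x} = ∈-tabulate⁻ (adj? x)

  adjacent-B⊆B : ∀ r {x z} → Adj x z → B r z ⊆ B (suc r) x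
  adjacent-B⊆B r {x} {z} xz {w} w∈ with _ , walk , n≤r ← ∈B⁻ r z w w∈ =
    ∈B⁺ (suc r) x w (cons xz walk) (s≤s n≤r)

  -- The ball contains the `k` neighbours of `z` and also `z` itself, which is not its own
  -- neighbour.
  ∣B₁∣>k : ∀ z → k < ∣ B 1 z ∣
  ∣B₁∣>k z = subst (_< ∣ B 1 z ∣) (regular z) (p⊂q⇒∣p∣<∣q∣
    ( (λ {w} w∈ → ∈B⁺ 1 z w (cons (∈neighbours⁻ w∈) nil) ≤-refl)
    , z , ∈B⁺ 1 z z nil z≤n , λ z∈ → irrefl (∈neighbours⁻ z∈) ))

  ∣B₁∩B₁∣≤N₁ : ∀ {z w} → z ≢ w → ∣ B 1 z ∩ B 1 w ∣ ≤ N 1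
  ∣B₁∩B₁∣≤N₁ {z} {w} = ≤maxOver (λ x y → ¬? (x ≟ y)) (λ x y → ∣ B 1 x ∩ B 1 y ∣) z w

  -- Common neighbours of two vertices at distance two

  module _ (x y : Fin v) (dxy≡2 : d x y ≡ 2) where

    C : Subset v
    C = neighbours Γ x ∩ neighbours Γ y

    C⇒Adjˡ : ∀ {z} → z ∈ C → Adj x z
    C⇒Adjˡ z∈ = ∈neighbours⁻ (proj₁ (x∈p∩q⁻ _ (neighbours Γ y) z∈))

    C⇒x∈B₁ : ∀ {z} → z ∈ C → x ∈ B 1 z
    C⇒x∈B₁ z∈ = ∈B⁺ 1 _ x (cons (Adj-sym (C⇒Adjˡ z∈)) nil) ≤-refl

    -- A walk of length at most 1 from `z` extends by the edge from `x`, or from `y`, to a walk of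
    -- length at most 2.
    C⇒B₁⊆ : ∀ {z} → z ∈ C → B 1 z ⊆ B 2 x ∩ B 2 y
    C⇒B₁⊆ z∈ w∈ = x∈p∩q⁺
      ( adjacent-B⊆B 1 (C⇒Adjˡ z∈) w∈
      , adjacent-B⊆B 1 (∈neighbours⁻ (proj₂ (x∈p∩q⁻ (neighbours Γ x) _ z∈))) w∈ )

    ⊆⇒∣p∣≤N₂ : ∀ {p} → p ⊆ B 2 x ∩ B 2 y → ∣ p ∣ ≤ N[d≡ 2 ] 2
    ⊆⇒∣p∣≤N₂ p⊆ = ≤-trans (p⊆q⇒∣p∣≤∣q∣ p⊆)
      (≤maxOver (λ x y → d x y ℕ.≟ 2) (λ x y → ∣ B 2 x ∩ B 2 y ∣) x y dxy≡2)

    one-common-neighbour : 1 ≤ ∣ C ∣ → k + 1 ≤ N[d≡ 2 ] 2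
    one-common-neighbour 1≤∣C∣ with z , z∈ , _ ← pick C 1≤∣C∣ = begin
      k + 1        ≡⟨ +-comm k 1 ⟩
      suc k        ≤⟨ ∣B₁∣>k z ⟩
      ∣ B 1 z ∣    ≤⟨ ⊆⇒∣p∣≤N₂ (C⇒B₁⊆ z∈) ⟩
      N[d≡ 2 ] 2   ∎
      where open ≤-Reasoning

    two-common-neighbours : 2 ≤ ∣ C ∣ → N 1 ≤ 2 → 2 * k ≤ N[d≡ 2 ] 2
    two-common-neighbours 2≤∣C∣ N₁≤2
      with z₁ , z₁∈ , 1≤ ← pick C 2≤∣C∣
      with z₂ , z₂∈ , _ ← pick (C - z₁) 1≤
      -- The cancelled 2 is the bound on the overlap of the two balls: 2(k + 1) - 2 = 2k.
      = ≤-trans (+-cancelʳ-≤ 2 _ _ 2k+2≤)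
                (⊆⇒∣p∣≤N₂ (∪-lub (C⇒B₁⊆ z₁∈) (C⇒B₁⊆ (p─q⊆p C _ z₂∈))))
      where
      open ≤-Reasoning
      b₁ b₂ : Subset v
      b₁ = B 1 z₁
      b₂ = B 1 z₂

      regroup : ∀ k → 2 * k + 2 ≡ suc k + suc k
      regroup = solve-∀

      2k+2≤ : 2 * k + 2 ≤ ∣ b₁ ∪ b₂ ∣ + 2
      2k+2≤ = begin
        2 * k + 2                    ≡⟨ regroup k ⟩
        suc k + suc k                ≤⟨ +-mono-≤ (∣B₁∣>k z₁) (∣B₁∣>k z₂) ⟩
        ∣ b₁ ∣ + ∣ b₂ ∣              ≡⟨ sym (∣p∪q∣+∣p∩q∣≡∣p∣+∣q∣ b₁ b₂) ⟩
        ∣ b₁ ∪ b₂ ∣ + ∣ b₁ ∩ b₂ ∣    ≤⟨ +-monoʳ-≤ _ (≤-trans (∣B₁∩B₁∣≤N₁ (x∈p-y⇒x≢y C z₂∈ ∘ sym)) N₁≤2) ⟩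
        ∣ b₁ ∪ b₂ ∣ + 2              ∎

    three-common-neighbours : 3 ≤ ∣ C ∣ → N 1 ≤ 3 → 3 * k ∸ 5 ≤ N[d≡ 2 ] 2
    three-common-neighbours 3≤∣C∣ N₁≤3
      with z₁ , z₁∈ , 2≤ ← pick C 3≤∣C∣
      with z₂ , z₂∈ , 1≤ ← pick (C - z₁) 2≤
      with z₃ , z₃∈ , _ ← pick (C - z₁ - z₂) 1≤
      -- Inclusion-exclusion gives 3(k + 1) - 3·3 + 1 = 3k - 5. Cancelling 4 leaves `3 * k` at most
      -- 5 plus the size of the union, and only then is 5 moved across as a truncated subtraction.
      = ≤-trans (m≤n+o⇒m∸n≤o _ 5 (+-cancelʳ-≤ 4 _ _ 3k+4≤))
                (⊆⇒∣p∣≤N₂ (∪-lub (C⇒B₁⊆ z₁∈) (∪-lub (C⇒B₁⊆ z₂∈C) (C⇒B₁⊆ z₃∈C))))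
      where
      open ≤-Reasoning
      b₁ b₂ b₃ : Subset v
      b₁ = B 1 z₁
      b₂ = B 1 z₂
      b₃ = B 1 z₃

      -- This intermediate membership shows that `z₃` differs from `z₁`; `z₃∈` itself shows that it
      -- differs from `z₂`.
      z₃∈C-z₁ : z₃ ∈ C - z₁
      z₃∈C-z₁ = p─q⊆p (C - z₁) _ z₃∈

      z₂∈C : z₂ ∈ C
      z₂∈C = p─q⊆p C _ z₂∈

      z₃∈C : z₃ ∈ C
      z₃∈C = p─q⊆p C _ z₃∈C-z₁

      pair≤3 : ∀ {z w} → w ≢ z → ∣ B 1 z ∩ B 1 w ∣ ≤ 3
      pair≤3 w≢z = ≤-trans (∣B₁∩B₁∣≤N₁ (w≢z ∘ sym)) N₁≤3

      regroup₁ : ∀ k → 3 * k + 4 ≡ suc k + suc k + suc k + 1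
      regroup₁ = solve-∀

      regroup₂ : ∀ u → u + (3 + 3 + 3) ≡ 5 + u + 4
      regroup₂ = solve-∀

      -- y is a second element of the triple intersection, but x alone suffices.
      3k+4≤ : 3 * k + 4 ≤ 5 + ∣ b₁ ∪ (b₂ ∪ b₃) ∣ + 4
      3k+4≤ = begin
        3 * k + 4
          ≡⟨ regroup₁ k ⟩
        suc k + suc k + suc k + 1
          ≤⟨ +-mono-≤ (+-mono-≤ (+-mono-≤ (∣B₁∣>k z₁) (∣B₁∣>k z₂)) (∣B₁∣>k z₃))
               (0<∣p∣ (x∈p∩q⁺ ( x∈p∩q⁺ (C⇒x∈B₁ z₁∈ , C⇒x∈B₁ z₂∈C)
                              , x∈p∩q⁺ (C⇒x∈B₁ z₁∈ , C⇒x∈B₁ z₃∈C)))) ⟩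
        ∣ b₁ ∣ + ∣ b₂ ∣ + ∣ b₃ ∣ + ∣ (b₁ ∩ b₂) ∩ (b₁ ∩ b₃) ∣
          ≡⟨ sym (∣p∪q∪r∣+∣pairs∣≡∣p∣+∣q∣+∣r∣+∣p∩q∩r∣ b₁ b₂ b₃) ⟩
        ∣ b₁ ∪ (b₂ ∪ b₃) ∣ + (∣ b₁ ∩ b₂ ∣ + ∣ b₁ ∩ b₃ ∣ + ∣ b₂ ∩ b₃ ∣)
          ≤⟨ +-monoʳ-≤ ∣ b₁ ∪ (b₂ ∪ b₃) ∣
               (+-mono-≤ (+-mono-≤ (pair≤3 (x∈p-y⇒x≢y C z₂∈)) (pair≤3 (x∈p-y⇒x≢y C z₃∈C-z₁)))
                         (pair≤3 (x∈p-y⇒x≢y (C - z₁) z₃∈))) ⟩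
        ∣ b₁ ∪ (b₂ ∪ b₃) ∣ + (3 + 3 + 3)
          ≡⟨ regroup₂ ∣ b₁ ∪ (b₂ ∪ b₃) ∣ ⟩
        5 + ∣ b₁ ∪ (b₂ ∪ b₃) ∣ + 4
          ∎

corollary1 : (v k : ℕ) (Γ : SimpleGraph v) (connected : Connected Γ) →
    let open Metric Γ connected in
    Regular Γ k →
    diameter ≥ 2 →
    v ≥ 4 →
    2 ≤ k → k ≤ v ∸ 2 →
    0 ≤ λᴳ → λᴳ ≤ k ∸ 2 →
    1 ≤ μᴳ → μᴳ ≤ k →
    (μᴳ ≡ 1 → N[d≡ 2 ] 2 ≥ k + 1)
    × (μᴳ ≡ 2 → N 1 ≡ 2 → N[d≡ 2 ] 2 ≥ 2 * k)
    × (μᴳ ≡ 3 → N 1 ≡ 3 → N[d≡ 2 ] 2 ≥ 3 * k ∸ 5)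
corollary1 v k Γ connected regular _ _ _ _ _ _ 1≤μ _
  -- Since μ is positive, it is attained at a pair at distance two; this one pair serves all three
  -- claims.
  with x , y , dxy≡2 , μ≡∣C∣ ← maxOver-attained (λ x y → Metric.d Γ connected x y ℕ.≟ 2)
                                                (commonNeighbours Γ) 1≤μ
  = (λ μ≡1 → one-common-neighbour Γ connected regular x y dxy≡2 (∣C∣≥ μ≡1))
  , (λ μ≡2 N₁≡2 → two-common-neighbours Γ connected regular x y dxy≡2 (∣C∣≥ μ≡2) (≤-reflexive N₁≡2))
  , (λ μ≡3 N₁≡3 → three-common-neighbours Γ connected regular x y dxy≡2 (∣C∣≥ μ≡3) (≤-reflexive N₁≡3))
  where
  ∣C∣≥ : ∀ {m} → Metric.μᴳ Γ connected ≡ m → m ≤ commonNeighbours Γ x y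
  ∣C∣≥ μ≡m = ≤-reflexive (trans (sym μ≡m) μ≡∣C∣)
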